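{- For every formula $\varphi\in\mathcal L^*$ in which the variable $p_\bot$ does not occur, $\varphi$ is valid on all $\mathsf{CK}$-models if and only if $\omega(\varphi)$ is valid on all $\mathsf{WK}$-models.
   Context: Language. Let $\mathrm{Prop}$ be a set of proposition symbols. $\mathcal L^*$ is given by $\varphi ::= \bot \mid p\mid \varphi\land\varphi \mid \varphi\lor\varphi \mid \varphi\to\varphi \mid \Box\varphi \mid \Diamond\varphi \mid \Box^*\varphi \mid \Diamond^*\varphi$, with $p\in\mathrm{Prop}$. Relations. $(R;S)$ is composition: $x(R;S)y$ iff there is $z$ with $xRz$ and $zSy$. $R^*$ is the reflexive-transitive closure of $R$. Models. A $\mathsf{CK}$-frame is a tuple $(W,\preccurlyeq,R)$ where $\preccurlyeq$ is a preorder on $W$ and $R$ is any binary relation on $W$. A $\mathsf{CK}$-model is $\mathcal M=(W,\preccurlyeq,R,\|\cdot\|)$, a $\mathsf{CK}$-frame with a map $\|\cdot\|:\mathrm{Prop}\cup\{\bot\}\to\mathcal P(W)$ such that for all $p\in\mathrm{Prop}$: (1) $\|\bot\|\subseteq\|p\|$; (2) if $w\preccurlyeq v$ and $w\in\|p\|$ then $v\in\|p\|$; (3) if $w\in\|\bot\|$ and ($w\preccurlyeq v$ or $wRv$) then $v\in\|\bot\|$; (4) if $w\in\|\bot\|$ then there is $v$ with $wRv$. A $\mathsf{WK}$-model is a $\mathsf{CK}$-model with $\|\bot\|=\varnothing$. Satisfaction. $(\mathcal M,w)\Vdash\bot$ iff $w\in\|\bot\|$; $(\mathcal M,w)\Vdash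 p$ iff $w\in\|p\|$; $\wedge,\vee$ are interpreted pointwise as usual; $(\mathcal M,w)\Vdash\varphi\to\psi$ iff for all $v\succcurlyeq w$, $(\mathcal M,v)\Vdash\varphi$ implies $(\mathcal M,v)\Vdash\psi$; $(\mathcal M,w)\Vdash\Box\varphi$ iff $(\mathcal M,v)\Vdash\varphi$ for all $v$ with $w(\preccurlyeq;R)v$; $(\mathcal M,w)\Vdash\Diamond\varphi$ iff for all $v\succcurlyeq w$ there is $u$ with $vRu$ and $(\mathcal M,u)\Vdash\varphi$; $(\mathcal M,w)\Vdash\Box^*\varphi$ iff $(\mathcal M,v)\Vdash\varphi$ for all $v$ with $w(\preccurlyeq;R)^*v$; $(\mathcal M,w)\Vdash\Diamond^*\varphi$ iff for all $v\succcurlyeq w$ there is $u$ with $vR^*u$ and $(\mathcal M,u)\Vdash\varphi$. A formula is valid on a model if it is satisfied at all its worlds. Translation. Fix a variable $p_\bot\in\mathrm{Prop}$. For a formula $\varphi$ not containing $p_\bot$, let $\mathrm{Var}(\varphi)$ be the set of propositional variables occurring in $\varphi$ and $P(\varphi)=\mathrm{Var}(\varphi)\cup\{p_\bot\}$. Then $\omega(\varphi)$ is the result of replacing every occurrence of $\bot$ in $\varphi$ by $\Box^*\big(\bigwedge P(\varphi)\wedge\Diamond p_\bot\big)$. -}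

module Defs where

open import Data.List.Base using (List; []; _∷_; [_]; _++_)
open import Data.List.NonEmpty as List⁺ using (List⁺; foldr₁) renaming (_∷_ to _∷⁺_)
open import Data.Product.Base using (_×_; ∃-syntax)
open import Data.Sum.Base using (_⊎_)
open import Level using (Level; suc)
open import Relation.Binary.Construct.Closure.ReflexiveTransitive using (Star)
open import Relation.Binary.Construct.Composition using (_;_)
open import Relation.Binary.Core using (Rel)
open import Relation.Binary.PropositionalEquality.Core using (_≡_)
open import Relation.Binary.Structures using (IsPreorder)
open import Relation.Unary using (Pred; _∈_; _⊆_; Empty)

private
  variable
    ℓ : Level
    Atom : Set ℓ

infixr 6 _∧_
infixr 5 _∨_
infixr 4 _⇒_
infix 7 □_ ◇_ □*_ ◇*_

data Formula (Atom : Set ℓ) : Set ℓ where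
  bot : Formula Atom
  var : Atom → Formula Atom
  _∧_ _∨_ _⇒_ : Formula Atom → Formula Atom → Formula Atom
  □_ ◇_ □*_ ◇*_ : Formula Atom → Formula Atom

-- The finite set Var(φ), listed from left to right with one entry per
-- occurrence; Atom need not have decidable equality.
Var : Formula Atom → List Atom
Var bot = []
Var (var p) = [ p ]
Var (φ ∧ ψ) = Var φ ++ Var ψ
Var (φ ∨ ψ) = Var φ ++ Var ψ
Var (φ ⇒ ψ) = Var φ ++ Var ψ
Var (□ φ) = Var φ
Var (◇ φ) = Var φ
Var (□* φ) = Var φ
Var (◇* φ) = Var φ

⋀ : List⁺ (Formula Atom) → Formula Atom
⋀ = foldr₁ _∧_

_[bot≔_] : Formula Atom → Formula Atom → Formula Atom
bot [bot≔ χ ] = χ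
var p [bot≔ χ ] = var p
(φ ∧ ψ) [bot≔ χ ] = φ [bot≔ χ ] ∧ ψ [bot≔ χ ]
(φ ∨ ψ) [bot≔ χ ] = φ [bot≔ χ ] ∨ ψ [bot≔ χ ]
(φ ⇒ ψ) [bot≔ χ ] = φ [bot≔ χ ] ⇒ ψ [bot≔ χ ]
(□ φ) [bot≔ χ ] = □ (φ [bot≔ χ ])
(◇ φ) [bot≔ χ ] = ◇ (φ [bot≔ χ ])
(□* φ) [bot≔ χ ] = □* (φ [bot≔ χ ])
(◇* φ) [bot≔ χ ] = ◇* (φ [bot≔ χ ])

P : Atom → Formula Atom → List⁺ Atom
P p⊥ φ = p⊥ ∷⁺ Var φ

ω : Atom → Formula Atom → Formula Atom
ω p⊥ φ = φ [bot≔ □* (⋀ (List⁺.map var (P p⊥ φ)) ∧ ◇ var p⊥) ]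

record CKFrame ℓ : Set (suc ℓ) where
  field
    W : Set ℓ
    _≼_ : Rel W ℓ
    R : Rel W ℓ
    ≼-isPreorder : IsPreorder _≡_ _≼_

-- The valuation on Prop ∪ {⊥} is split into its restriction V to the
-- proposition symbols and its value ‖⊥‖ at ⊥.
record CKModel (Atom : Set ℓ) : Set (suc ℓ) where
  field
    frame : CKFrame ℓ
  open CKFrame frame public
  field
    V : Atom → Pred W ℓ
    ‖⊥‖ : Pred W ℓ
    ‖⊥‖⊆V : ∀ p → ‖⊥‖ ⊆ V p
    V-persistent : ∀ p {w v} → w ≼ v → w ∈ V p → v ∈ V p
    ‖⊥‖-closed : ∀ {w v} → w ∈ ‖⊥‖ → w ≼ v ⊎ R w v → v ∈ ‖⊥‖
    ‖⊥‖-serial : ∀ {w} → w ∈ ‖⊥‖ → ∃[ v ] R w v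

record WKModel (Atom : Set ℓ) : Set (suc ℓ) where
  field
    ckModel : CKModel Atom
  open CKModel ckModel public
  field
    ‖⊥‖-empty : Empty ‖⊥‖

module _ {Atom : Set ℓ} (M : CKModel Atom) where
  open CKModel M

  infix 3 _⊩_

  _⊩_ : W → Formula Atom → Set ℓ
  w ⊩ bot = w ∈ ‖⊥‖
  w ⊩ var p = w ∈ V p
  w ⊩ φ ∧ ψ = (w ⊩ φ) × (w ⊩ ψ)
  w ⊩ φ ∨ ψ = (w ⊩ φ) ⊎ (w ⊩ ψ)
  w ⊩ φ ⇒ ψ = ∀ v → w ≼ v → v ⊩ φ → v ⊩ ψ
  w ⊩ □ φ = ∀ v → (_≼_ ; R) w v → v ⊩ φ
  w ⊩ ◇ φ = ∀ v → w ≼ v → ∃[ u ] R v u × (u ⊩ φ)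
  w ⊩ □* φ = ∀ v → Star (_≼_ ; R) w v → v ⊩ φ
  w ⊩ ◇* φ = ∀ v → w ≼ v → ∃[ u ] Star R v u × (u ⊩ φ)

  Valid : Formula Atom → Set ℓ
  Valid φ = ∀ w → w ⊩ φ

CK-valid : {Atom : Set ℓ} → Formula Atom → Set (suc ℓ)
CK-valid {Atom = Atom} φ = (M : CKModel Atom) → Valid M φ

WK-valid : {Atom : Set ℓ} → Formula Atom → Set (suc ℓ)
WK-valid {Atom = Atom} φ = (M : WKModel Atom) → Valid (WKModel.ckModel M) φ

{-# OPTIONS --safe #-}

-- Over a fixed frame, a CK-valuation and a WK-valuation determine each other
-- up to the atoms of φ. From a WK-model, take ‖⊥‖ to be the truth set of
-- □*(⋀ P(φ) ∧ ◇ p⊥), which is closed and serial, and enlarge every V p by it.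
-- From a CK-model, store ‖⊥‖ in the fresh variable p⊥ and make ⊥ false: the
-- closure and seriality of ‖⊥‖ say that □*(⋀ P(φ) ∧ ◇ p⊥) holds exactly on it.
-- Either way ⊥ on the CK side is the substituted formula on the WK side.
module Submission where

open import Defs
open import Data.Empty.Polymorphic using (⊥)
open import Data.List.Base using ([]; _∷_)
open import Data.List.NonEmpty as List⁺ using () renaming (_∷_ to _∷⁺_)
open import Data.List.Membership.Propositional using (_∈_; _∉_)
open import Data.List.Membership.Propositional.Properties using (∈-++⁺ˡ; ∈-++⁺ʳ)
open import Data.List.Relation.Unary.Any using (here; there)
open import Data.Product.Base using (_×_; _,_; proj₁; proj₂; ∃-syntax; map₂)
open import Data.Product.Function.NonDependent.Propositional using (_×-⇔_)
open import Data.Sum.Base using (_⊎_; inj₁; inj₂; [_,_]′; map)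
open import Data.Sum.Function.Propositional using (_⊎-⇔_)
open import Function.Base using (id; _∘_)
open import Function.Bundles using (_⇔_; mk⇔; Equivalence)
open import Function.Construct.Identity using (⇔-id)
open import Level using (Level; suc)
open import Relation.Binary.Construct.Closure.ReflexiveTransitive using (Star; ε; _◅_)
open import Relation.Binary.Construct.Composition using (_;_)
open import Relation.Binary.PropositionalEquality.Core using (_≡_; refl)
open import Relation.Binary.Structures using (IsPreorder)
open import Relation.Nullary.Negation using (contradiction)
open import Relation.Unary using (Pred; _⊆_)

open Equivalence using (to; from)

private
  variable
    ℓ : Level
    Atom : Set ℓ

-- The frame is a parameter here, so two valuations share `W` definitionally and truth at the same
-- world can be compared.
record Valuation (Atom : Set ℓ) (F : CKFrame ℓ) : Set (suc ℓ) where
  open CKFrame F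
  field
    V : Atom → Pred W ℓ
    ‖⊥‖ : Pred W ℓ
    ‖⊥‖⊆V : ∀ p → ‖⊥‖ ⊆ V p
    V-persistent : ∀ p {w v} → w ≼ v → V p w → V p v
    ‖⊥‖-closed : ∀ {w v} → ‖⊥‖ w → w ≼ v ⊎ R w v → ‖⊥‖ v
    ‖⊥‖-serial : ∀ {w} → ‖⊥‖ w → ∃[ v ] R w v

  model : CKModel Atom
  model = record
    { frame = F ; V = V ; ‖⊥‖ = ‖⊥‖ ; ‖⊥‖⊆V = ‖⊥‖⊆V ; V-persistent = V-persistent
    ; ‖⊥‖-closed = ‖⊥‖-closed ; ‖⊥‖-serial = ‖⊥‖-serial }

module _ {F : CKFrame ℓ} (X Y : Valuation Atom F) where
  open CKFrame F
  private
    module X = Valuation X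
    module Y = Valuation Y

  -- By induction on `ψ`: the clauses for connectives and modalities mention only the common frame,
  -- so agreement at the leaves, `bot` and the atoms of `ψ`, propagates upwards.
  ⊩-[bot≔] : ∀ χ → (∀ {w} → X.‖⊥‖ w ⇔ (Y.model ⊩ w) χ) →
    ∀ ψ → (∀ {p} → p ∈ Var ψ → ∀ {w} → X.V p w ⇔ Y.V p w) →
    ∀ {w} → (X.model ⊩ w) ψ ⇔ (Y.model ⊩ w) (ψ [bot≔ χ ])
  ⊩-[bot≔] χ ⊥⇔χ = go
    where
    go : ∀ ψ → (∀ {p} → p ∈ Var ψ → ∀ {w} → X.V p w ⇔ Y.V p w) →
      ∀ {w} → (X.model ⊩ w) ψ ⇔ (Y.model ⊩ w) (ψ [bot≔ χ ])
    go bot V⇔ = ⊥⇔χ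
    go (var p) V⇔ = V⇔ (here refl)
    go (ψ ∧ θ) V⇔ = go ψ (V⇔ ∘ ∈-++⁺ˡ) ×-⇔ go θ (V⇔ ∘ ∈-++⁺ʳ (Var ψ))
    go (ψ ∨ θ) V⇔ = go ψ (V⇔ ∘ ∈-++⁺ˡ) ⊎-⇔ go θ (V⇔ ∘ ∈-++⁺ʳ (Var ψ))
    go (ψ ⇒ θ) V⇔ = mk⇔
      (λ h v w≼v → to ihθ ∘ h v w≼v ∘ from ihψ)
      (λ h v w≼v → from ihθ ∘ h v w≼v ∘ to ihψ)
      where
      ihψ : ∀ {w} → (X.model ⊩ w) ψ ⇔ (Y.model ⊩ w) (ψ [bot≔ χ ])
      ihψ = go ψ (V⇔ ∘ ∈-++⁺ˡ)
      ihθ : ∀ {w} → (X.model ⊩ w) θ ⇔ (Y.model ⊩ w) (θ [bot≔ χ ])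
      ihθ = go θ (V⇔ ∘ ∈-++⁺ʳ (Var ψ))
    go (□ ψ) V⇔ = mk⇔ (λ h v → to (go ψ V⇔) ∘ h v) (λ h v → from (go ψ V⇔) ∘ h v)
    go (□* ψ) V⇔ = mk⇔ (λ h v → to (go ψ V⇔) ∘ h v) (λ h v → from (go ψ V⇔) ∘ h v)
    go (◇ ψ) V⇔ = mk⇔
      (λ h v → map₂ (map₂ (to (go ψ V⇔))) ∘ h v)
      (λ h v → map₂ (map₂ (from (go ψ V⇔))) ∘ h v)
    go (◇* ψ) V⇔ = mk⇔
      (λ h v → map₂ (map₂ (to (go ψ V⇔))) ∘ h v)
      (λ h v → map₂ (map₂ (from (go ψ V⇔))) ∘ h v)

module _ {Atom : Set ℓ} (M : CKModel Atom) where
  open CKModel M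
  open IsPreorder ≼-isPreorder using () renaming (refl to ≼-refl; trans to ≼-trans)

  ⊩-persistent : ∀ φ {w v} → w ≼ v → (M ⊩ w) φ → (M ⊩ v) φ
  ⊩-persistent bot w≼v h = ‖⊥‖-closed h (inj₁ w≼v)
  ⊩-persistent (var p) w≼v = V-persistent p w≼v
  ⊩-persistent (φ ∧ ψ) w≼v (h , k) = ⊩-persistent φ w≼v h , ⊩-persistent ψ w≼v k
  ⊩-persistent (φ ∨ ψ) w≼v = map (⊩-persistent φ w≼v) (⊩-persistent ψ w≼v)
  ⊩-persistent (φ ⇒ ψ) w≼v h u v≼u = h u (≼-trans w≼v v≼u)
  ⊩-persistent (□ φ) w≼v h u (x , v≼x , xRu) = h u (x , ≼-trans w≼v v≼x , xRu)
  ⊩-persistent (◇ φ) w≼v h u v≼u = h u (≼-trans w≼v v≼u)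
  -- Only the empty path calls on persistence of `φ`; a nonempty one begins with a `≼`-step, which
  -- absorbs `w≼v`.
  ⊩-persistent (□* φ) w≼v h u ε = ⊩-persistent φ w≼v (h _ ε)
  ⊩-persistent (□* φ) w≼v h u ((x , v≼x , xRy) ◅ y⟶u) =
    h u ((x , ≼-trans w≼v v≼x , xRy) ◅ y⟶u)
  ⊩-persistent (◇* φ) w≼v h u v≼u = h u (≼-trans w≼v v≼u)

  -- Reflexivity of `≼` turns an `R`-step into a `(_≼_ ; R)`-step, to be prepended to any path. This
  -- gives closure of `‖⊥‖` under `R` in `explode`.
  ⊩-□*-step : ∀ φ {w v} → R w v → (M ⊩ w) (□* φ) → (M ⊩ v) (□* φ)
  ⊩-□*-step φ wRv h u v⟶u = h u ((_ , ≼-refl , wRv) ◅ v⟶u)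

  ⊩-⋀-var : ∀ p ps {w} →
    (M ⊩ w) (⋀ (List⁺.map var (p ∷⁺ ps))) ⇔ (∀ {q} → q ∈ p ∷ ps → V q w)
  ⊩-⋀-var p [] = mk⇔ (λ { h (here refl) → h }) (λ h → h (here refl))
  ⊩-⋀-var p (q ∷ ps) = mk⇔
    (λ { (h , _) (here refl) → h ; (_ , hs) (there r∈) → to (⊩-⋀-var q ps) hs r∈ })
    (λ h → h (here refl) , from (⊩-⋀-var q ps) (λ r∈ → h (there r∈)))

  ‖⊥‖-closed* : ∀ {w v} → ‖⊥‖ w → Star (_≼_ ; R) w v → ‖⊥‖ v
  ‖⊥‖-closed* h ε = h
  ‖⊥‖-closed* h ((_ , w≼x , xRy) ◅ y⟶v) =
    ‖⊥‖-closed* (‖⊥‖-closed (‖⊥‖-closed h (inj₁ w≼x)) (inj₂ xRy)) y⟶v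

ω⊥ : Atom → Formula Atom → Formula Atom
ω⊥ p⊥ φ = □* (⋀ (List⁺.map var (P p⊥ φ)) ∧ ◇ var p⊥)

module _ (p⊥ : Atom) (φ : Formula Atom) (M : CKModel Atom) where
  open CKModel M
  open IsPreorder ≼-isPreorder using () renaming (refl to ≼-refl)

  explode : Valuation Atom frame
  explode = record
    { V = λ p w → V p w ⊎ (M ⊩ w) χ
    ; ‖⊥‖ = λ w → (M ⊩ w) χ
    ; ‖⊥‖⊆V = λ _ → inj₂
    ; V-persistent = λ p w≼v → map (V-persistent p w≼v) (⊩-persistent M χ w≼v)
    ; ‖⊥‖-closed = λ h →
        [ (λ w≼v → ⊩-persistent M χ w≼v h)
        , (λ wRv → ⊩-□*-step M (⋀ (List⁺.map var (P p⊥ φ)) ∧ ◇ var p⊥) wRv h)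
        ]′
    -- The empty path yields `◇ var p⊥` at the world itself, and reflexivity of `≼` then yields an
    -- `R`-successor of that very world.
    ; ‖⊥‖-serial = λ h → map₂ proj₁ (proj₂ (h _ ε) _ ≼-refl)
    }
    where
    χ : Formula Atom
    χ = ω⊥ p⊥ φ

  valid-ω : CK-valid φ → Valid M (ω p⊥ φ)
  valid-ω ck w =
    to (⊩-[bot≔] explode (record { CKModel M }) (ω⊥ p⊥ φ) (⇔-id _) φ V⇔)
      (ck (Valuation.model explode) w)
    where
    V⇔ : ∀ {p} → p ∈ Var φ → ∀ {w} → Valuation.V explode p w ⇔ V p w
    -- Enlarging `V p` adds no world when `p` occurs in `φ`: along the empty path, `ω⊥ p⊥ φ` already
    -- forces every atom of `φ`.
    V⇔ p∈φ = mk⇔ [ id , (λ h → to (⊩-⋀-var M p⊥ (Var φ)) (proj₁ (h _ ε)) (there p∈φ)) ]′ inj₁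

  -- Membership of p in V is cut down by p ≡ p⊥ → ‖⊥‖ rather than by a case
  -- split, as equality of atoms need not be decidable.
  defuse : Valuation Atom frame
  defuse = record
    { V = λ p w → V p w × (p ≡ p⊥ → ‖⊥‖ w)
    ; ‖⊥‖ = λ _ → ⊥
    ; ‖⊥‖⊆V = λ _ ()
    ; V-persistent = λ p w≼v (h , k) → V-persistent p w≼v h , λ e → ‖⊥‖-closed (k e) (inj₁ w≼v)
    ; ‖⊥‖-closed = λ ()
    ; ‖⊥‖-serial = λ ()
    }

  ‖⊥‖⇔defuse-ω⊥ : ∀ {w} → ‖⊥‖ w ⇔ (Valuation.model defuse ⊩ w) (ω⊥ p⊥ φ)
  ‖⊥‖⇔defuse-ω⊥ = mk⇔
    (λ b v w⟶v → let bᵥ = ‖⊥‖-closed* M b w⟶v in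
        from (⊩-⋀-var N p⊥ (Var φ)) (λ {q} _ → ‖⊥‖⊆V q bᵥ , λ _ → bᵥ)
      -- Seriality supplies the successor `x` of `u`, and closure puts `x` in `‖⊥‖`, where `p⊥` is
      -- true in `defuse`.
      , λ u v≼u → let bᵤ = ‖⊥‖-closed bᵥ (inj₁ v≼u) ; (x , uRx) = ‖⊥‖-serial bᵤ
                      bₓ = ‖⊥‖-closed bᵤ (inj₂ uRx)
                  in x , uRx , ‖⊥‖⊆V p⊥ bₓ , λ _ → bₓ)
    -- The conjunct `p⊥` at the empty path carries the guard `p⊥ ≡ p⊥ → ‖⊥‖ w`, which `refl` opens.
    (λ h → proj₂ (to (⊩-⋀-var N p⊥ (Var φ)) (proj₁ (h _ ε)) (here refl)) refl)
    where
    N : CKModel Atom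
    N = Valuation.model defuse

  valid-from-ω : p⊥ ∉ Var φ → WK-valid (ω p⊥ φ) → Valid M φ
  valid-from-ω p⊥∉φ wk w =
    from (⊩-[bot≔] (record { CKModel M }) defuse (ω⊥ p⊥ φ) ‖⊥‖⇔defuse-ω⊥ φ V⇔)
      (wk (record { ckModel = Valuation.model defuse ; ‖⊥‖-empty = λ _ () }) w)
    where
    V⇔ : ∀ {p} → p ∈ Var φ → ∀ {w} → V p w ⇔ Valuation.V defuse p w
    -- Freshness of `p⊥` makes the guard vacuous on the atoms of `φ`.
    V⇔ p∈φ = mk⇔ (λ h → h , λ { refl → contradiction p∈φ p⊥∉φ }) proj₁

theorem3p6 : ∀ {ℓ} {Atom : Set ℓ} (p⊥ : Atom) (φ : Formula Atom) → p⊥ ∉ Var φ →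
    CK-valid φ ⇔ WK-valid (ω p⊥ φ)
theorem3p6 p⊥ φ p⊥∉φ = mk⇔
  (λ ck M → valid-ω p⊥ φ (WKModel.ckModel M) ck)
  (λ wk M → valid-from-ω p⊥ φ M p⊥∉φ wk)
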